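{- Let $\mathbf{x}=(x_s)\in(\mathbb{R}_{>0})^{\mathbb{Z}^3}$ satisfy the positive Kashaev recurrence: for every $v\in\mathbb{Z}^3$, writing $z_{ijk}=x_{v+(i,j,k)}$ for $i,j,k\in\{0,1\}$, $$z_{111}=\frac{A+2\sqrt{D}}{z_{000}^2},$$ where $A=2z_{100}z_{010}z_{001}+z_{000}(z_{100}z_{011}+z_{010}z_{101}+z_{001}z_{110})$, $D=(z_{000}z_{011}+z_{010}z_{001})(z_{000}z_{101}+z_{100}z_{001})(z_{000}z_{110}+z_{100}z_{010})$, and $\sqrt{D}$ is the positive square root. Then for every $v\in\mathbb{Z}^3$, $$\prod_{C\ni v}K^C_v(\mathbf{x})=\prod_{S\ni v}(x_vx_{v_2}+x_{v_1}x_{v_3}),$$ where the first product is over the $8$ unit cubes $C$ in $\mathbb{Z}^3$ containing $v$, and the second is over the $12$ unit squares $S$ containing $v$, with $v,v_1,v_2,v_3$ the vertices of $S$ in cyclic order.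
   Context: For a unit cube $C$ in $\mathbb{Z}^3$ with vertex $v$ and $\mathbf{x}\in\mathbb{C}^{\mathbb{Z}^3}$, label the values of $\mathbf{x}$ at the vertices of $C$ as $z_{ijk}$, $i,j,k\in\{0,1\}$, via an identification of $C$ with $\{0,1\}^3$ (a cube isomorphism) sending $v$ to $000$, and set $K^C_v(\mathbf{x})=\tfrac12\big(z_{111}z_{000}^2-z_{000}(z_{100}z_{011}+z_{010}z_{101}+z_{001}z_{110})\big)-z_{100}z_{010}z_{001}$ (independent of the choice of identification). -}

module Defs where

open import Data.Bool.Base using (Bool; true; false; not; _xor_)
open import Data.Fin.Base using (Fin; zero; suc)
open import Data.Integer.Base as ℤ using (ℤ; 0ℤ; 1ℤ)
import Data.Integer.Properties as ℤₚ
open import Data.List.Base using (List; []; _∷_; map; foldr; cartesianProduct; length)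
open import Data.List.Membership.Propositional using (_∈_)
open import Data.List.Membership.Propositional.Properties using (∈-map⁺; ∈-map⁻; ∈-cartesianProduct⁺)
open import Data.List.Relation.Unary.All using ([]; _∷_)
open import Data.List.Relation.Unary.Any using (here; there)
open import Data.List.Relation.Unary.Unique.Propositional using (Unique; []; _∷_)
import Data.List.Relation.Unary.Unique.Propositional.Properties as Unique
open import Data.Nat.Base as ℕ using (ℕ)
import Data.Nat.Properties as ℕₚ
open import Data.Product.Base using (Σ; ∃; _×_; _,_; proj₁; proj₂)
open import Data.Rational.Base as ℚ using (ℚ; 0ℚ; 1ℚ; ½)
import Data.Rational.Properties as ℚₚ
open import Data.Rational.Solver using (module +-*-Solver)
open import Function.Bundles using (_⇔_; mk⇔)
open import Relation.Binary.PropositionalEquality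

-- Real numbers: Cauchy sequences of rationals, as a setoid under _≈_

IsCauchy : (ℕ → ℚ) → Set
IsCauchy a = ∀ ε → 0ℚ ℚ.< ε →
  ∃ λ N → ∀ m n → N ℕ.≤ m → N ℕ.≤ n → ℚ.∣ a m ℚ.- a n ∣ ℚ.≤ ε

-- No η, and operations given by copatterns: terms such as x * y then stay
-- folded during conversion checking.
record ℝ : Set where
  no-eta-equality
  constructor mkℝ
  field
    seq    : ℕ → ℚ
    cauchy : IsCauchy seq

open ℝ public

infix 4 _≈_

record _≈_ (x y : ℝ) : Set where
  constructor mk≈
  field
    close : ∀ ε → 0ℚ ℚ.< ε → ∃ λ N → ∀ n → N ℕ.≤ n → ℚ.∣ seq x n ℚ.- seq y n ∣ ℚ.≤ ε

record Positive (x : ℝ) : Set where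
  constructor mkPositive
  field
    bound   : ℚ
    bound>0 : 0ℚ ℚ.< bound
    index   : ℕ
    above   : ∀ n → index ℕ.≤ n → bound ℚ.≤ seq x n

module CauchyLemmas where
  open ℚₚ.≤-Reasoning

  pos* : ∀ {p q} → 0ℚ ℚ.< p → 0ℚ ℚ.< q → 0ℚ ℚ.< p ℚ.* q
  pos* {p} {q} p>0 q>0 = ℚₚ.positive⁻¹ _ {{ℚₚ.pos*pos⇒pos p {{ℚ.positive p>0}} q {{ℚ.positive q>0}}}}

  recip : ∀ p → 0ℚ ℚ.< p → ℚ
  recip p p>0 = (ℚ.1/ p) {{ℚₚ.pos⇒nonZero p {{ℚ.positive p>0}}}}

  recip>0 : ∀ p (p>0 : 0ℚ ℚ.< p) → 0ℚ ℚ.< recip p p>0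
  recip>0 p p>0 = ℚₚ.positive⁻¹ _ {{ℚₚ.1/pos⇒pos p {{ℚ.positive p>0}}}}

  recip-inverse : ∀ p (p>0 : 0ℚ ℚ.< p) → p ℚ.* recip p p>0 ≡ 1ℚ
  recip-inverse p p>0 = ℚₚ.*-inverseʳ p {{ℚₚ.pos⇒nonZero p {{ℚ.positive p>0}}}}

  *-mono-≤ : ∀ {p q r s} → 0ℚ ℚ.≤ r → 0ℚ ℚ.≤ q → p ℚ.≤ q → r ℚ.≤ s → p ℚ.* r ℚ.≤ q ℚ.* s
  *-mono-≤ {p} {q} {r} {s} 0≤r 0≤q p≤q r≤s = ℚₚ.≤-trans
    (ℚₚ.*-monoʳ-≤-nonNeg r {{ℚ.nonNegative 0≤r}} p≤q)
    (ℚₚ.*-monoˡ-≤-nonNeg q {{ℚ.nonNegative 0≤q}} r≤s)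

  half : ∀ {ε} → 0ℚ ℚ.< ε → 0ℚ ℚ.< ε ℚ.* ½
  half ε>0 = pos* ε>0 (ℚₚ.positive⁻¹ ½)

  half+half : ∀ ε → ε ℚ.* ½ ℚ.+ ε ℚ.* ½ ≡ ε
  half+half ε = trans (sym (ℚₚ.*-distribˡ-+ ε ½ ½)) (ℚₚ.*-identityʳ ε)

  bounded : ∀ {a} → IsCauchy a →
    ∃ λ B → 0ℚ ℚ.< B × ∃ λ N → ∀ n → N ℕ.≤ n → ℚ.∣ a n ∣ ℚ.≤ B
  bounded {a} a-cauchy with a-cauchy 1ℚ (ℚₚ.positive⁻¹ 1ℚ)
  ... | N , near = 1ℚ ℚ.+ ℚ.∣ a N ∣ , B>0 , N , λ n N≤n → begin
      ℚ.∣ a n ∣                            ≡⟨ cong ℚ.∣_∣ (split (a n) (a N)) ⟩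
      ℚ.∣ (a n ℚ.- a N) ℚ.+ a N ∣          ≤⟨ ℚₚ.∣p+q∣≤∣p∣+∣q∣ (a n ℚ.- a N) (a N) ⟩
      ℚ.∣ a n ℚ.- a N ∣ ℚ.+ ℚ.∣ a N ∣      ≤⟨ ℚₚ.+-monoˡ-≤ ℚ.∣ a N ∣ (near n N N≤n ℕₚ.≤-refl) ⟩
      1ℚ ℚ.+ ℚ.∣ a N ∣                     ∎
    where
    open +-*-Solver
    B>0 : 0ℚ ℚ.< 1ℚ ℚ.+ ℚ.∣ a N ∣
    B>0 = ℚₚ.+-mono-<-≤ (ℚₚ.positive⁻¹ 1ℚ) (ℚₚ.0≤∣p∣ (a N))
    split : ∀ p q → p ≡ (p ℚ.- q) ℚ.+ q
    split = solve 2 (λ p q → p := (p :- q) :+ q) refl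

  +-cauchy : ∀ {a b} → IsCauchy a → IsCauchy b → IsCauchy (λ n → a n ℚ.+ b n)
  +-cauchy {a} {b} ca cb ε ε>0 with ca (ε ℚ.* ½) (half ε>0) | cb (ε ℚ.* ½) (half ε>0)
  ... | M , near-a | N , near-b = M ℕ.⊔ N , λ m n p q → begin
      ℚ.∣ (a m ℚ.+ b m) ℚ.- (a n ℚ.+ b n) ∣            ≡⟨ cong ℚ.∣_∣ (swap (a m) (b m) (a n) (b n)) ⟩
      ℚ.∣ (a m ℚ.- a n) ℚ.+ (b m ℚ.- b n) ∣            ≤⟨ ℚₚ.∣p+q∣≤∣p∣+∣q∣ (a m ℚ.- a n) (b m ℚ.- b n) ⟩
      ℚ.∣ a m ℚ.- a n ∣ ℚ.+ ℚ.∣ b m ℚ.- b n ∣          ≤⟨ ℚₚ.+-mono-≤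
          (near-a m n (ℕₚ.m⊔n≤o⇒m≤o M N p) (ℕₚ.m⊔n≤o⇒m≤o M N q))
          (near-b m n (ℕₚ.m⊔n≤o⇒n≤o M N p) (ℕₚ.m⊔n≤o⇒n≤o M N q)) ⟩
      ε ℚ.* ½ ℚ.+ ε ℚ.* ½                              ≡⟨ half+half ε ⟩
      ε                                                ∎
    where
    open +-*-Solver
    swap : ∀ p q r s → (p ℚ.+ q) ℚ.- (r ℚ.+ s) ≡ (p ℚ.- r) ℚ.+ (q ℚ.- s)
    swap = solve 4 (λ p q r s → (p :+ q) :- (r :+ s) := (p :- r) :+ (q :- s)) refl

  neg-cauchy : ∀ {a} → IsCauchy a → IsCauchy (λ n → ℚ.- a n)
  neg-cauchy {a} ca ε ε>0 with ca ε ε>0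
  ... | N , near = N , λ m n p q → begin
      ℚ.∣ ℚ.- a m ℚ.- ℚ.- a n ∣    ≡⟨ cong ℚ.∣_∣ (flip (a m) (a n)) ⟩
      ℚ.∣ a n ℚ.- a m ∣            ≤⟨ near n m q p ⟩
      ε                            ∎
    where
    open +-*-Solver
    flip : ∀ p q → ℚ.- p ℚ.- ℚ.- q ≡ q ℚ.- p
    flip = solve 2 (λ p q → :- p :- (:- q) := q :- p) refl

  *-bound : ∀ e C p q (e>0 : 0ℚ ℚ.< e) (C>0 : 0ℚ ℚ.< C) →
    ℚ.∣ p ∣ ℚ.≤ e ℚ.* recip C C>0 → ℚ.∣ q ∣ ℚ.≤ C → ℚ.∣ p ℚ.* q ∣ ℚ.≤ e
  *-bound e C p q e>0 C>0 p≤ q≤ = begin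
      ℚ.∣ p ℚ.* q ∣                    ≡⟨ ℚₚ.∣p*q∣≡∣p∣*∣q∣ p q ⟩
      ℚ.∣ p ∣ ℚ.* ℚ.∣ q ∣              ≤⟨ *-mono-≤ (ℚₚ.0≤∣p∣ q)
          (ℚₚ.<⇒≤ (pos* e>0 (recip>0 C C>0))) p≤ q≤ ⟩
      e ℚ.* recip C C>0 ℚ.* C          ≡⟨ ℚₚ.*-assoc e (recip C C>0) C ⟩
      e ℚ.* (recip C C>0 ℚ.* C)        ≡⟨ cong (e ℚ.*_)
          (trans (ℚₚ.*-comm (recip C C>0) C) (recip-inverse C C>0)) ⟩
      e ℚ.* 1ℚ                         ≡⟨ ℚₚ.*-identityʳ e ⟩
      e                                ∎

  *-cauchy : ∀ {a b} → IsCauchy a → IsCauchy b → IsCauchy (λ n → a n ℚ.* b n)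
  *-cauchy {a} {b} ca cb ε ε>0 = (N₁ ℕ.⊔ N₂) ℕ.⊔ (N₃ ℕ.⊔ N₄), λ m n p q → begin
      ℚ.∣ a m ℚ.* b m ℚ.- a n ℚ.* b n ∣                                ≡⟨ cong ℚ.∣_∣ (split (a m) (b m) (a n) (b n)) ⟩
      ℚ.∣ (b m ℚ.- b n) ℚ.* a m ℚ.+ (a m ℚ.- a n) ℚ.* b n ∣            ≤⟨ ℚₚ.∣p+q∣≤∣p∣+∣q∣ ((b m ℚ.- b n) ℚ.* a m) ((a m ℚ.- a n) ℚ.* b n) ⟩
      ℚ.∣ (b m ℚ.- b n) ℚ.* a m ∣ ℚ.+ ℚ.∣ (a m ℚ.- a n) ℚ.* b n ∣      ≤⟨ ℚₚ.+-mono-≤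
          (*-bound (ε ℚ.* ½) A (b m ℚ.- b n) (a m) (half ε>0) A>0 (near-b m n (i₄ p) (i₄ q)) (a≤A m (i₁ p)))
          (*-bound (ε ℚ.* ½) B (a m ℚ.- a n) (b n) (half ε>0) B>0 (near-a m n (i₃ p) (i₃ q)) (b≤B n (i₂ q))) ⟩
      ε ℚ.* ½ ℚ.+ ε ℚ.* ½                                              ≡⟨ half+half ε ⟩
      ε                                                                ∎
    where
    open +-*-Solver
    bound-a = bounded ca
    bound-b = bounded cb
    A = proj₁ bound-a
    A>0 = proj₁ (proj₂ bound-a)
    N₁ = proj₁ (proj₂ (proj₂ bound-a))
    a≤A = proj₂ (proj₂ (proj₂ bound-a))
    B = proj₁ bound-b
    B>0 = proj₁ (proj₂ bound-b)
    N₂ = proj₁ (proj₂ (proj₂ bound-b))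
    b≤B = proj₂ (proj₂ (proj₂ bound-b))
    mod-a = ca (ε ℚ.* ½ ℚ.* recip B B>0) (pos* (half ε>0) (recip>0 B B>0))
    mod-b = cb (ε ℚ.* ½ ℚ.* recip A A>0) (pos* (half ε>0) (recip>0 A A>0))
    N₃ = proj₁ mod-a
    N₄ = proj₁ mod-b
    near-a = proj₂ mod-a
    near-b = proj₂ mod-b
    split : ∀ p q r s → p ℚ.* q ℚ.- r ℚ.* s ≡ (q ℚ.- s) ℚ.* p ℚ.+ (p ℚ.- r) ℚ.* s
    split = solve 4 (λ p q r s → p :* q :- r :* s := (q :- s) :* p :+ (p :- r) :* s) refl
    i₁ : ∀ {k} → (N₁ ℕ.⊔ N₂) ℕ.⊔ (N₃ ℕ.⊔ N₄) ℕ.≤ k → N₁ ℕ.≤ k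
    i₁ p = ℕₚ.m⊔n≤o⇒m≤o N₁ N₂ (ℕₚ.m⊔n≤o⇒m≤o (N₁ ℕ.⊔ N₂) (N₃ ℕ.⊔ N₄) p)
    i₂ : ∀ {k} → (N₁ ℕ.⊔ N₂) ℕ.⊔ (N₃ ℕ.⊔ N₄) ℕ.≤ k → N₂ ℕ.≤ k
    i₂ p = ℕₚ.m⊔n≤o⇒n≤o N₁ N₂ (ℕₚ.m⊔n≤o⇒m≤o (N₁ ℕ.⊔ N₂) (N₃ ℕ.⊔ N₄) p)
    i₃ : ∀ {k} → (N₁ ℕ.⊔ N₂) ℕ.⊔ (N₃ ℕ.⊔ N₄) ℕ.≤ k → N₃ ℕ.≤ k
    i₃ p = ℕₚ.m⊔n≤o⇒m≤o N₃ N₄ (ℕₚ.m⊔n≤o⇒n≤o (N₁ ℕ.⊔ N₂) (N₃ ℕ.⊔ N₄) p)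
    i₄ : ∀ {k} → (N₁ ℕ.⊔ N₂) ℕ.⊔ (N₃ ℕ.⊔ N₄) ℕ.≤ k → N₄ ℕ.≤ k
    i₄ p = ℕₚ.m⊔n≤o⇒n≤o N₃ N₄ (ℕₚ.m⊔n≤o⇒n≤o (N₁ ℕ.⊔ N₂) (N₃ ℕ.⊔ N₄) p)

  recip-antitone : ∀ {p q} (p>0 : 0ℚ ℚ.< p) (q>0 : 0ℚ ℚ.< q) → p ℚ.≤ q → recip q q>0 ℚ.≤ recip p p>0
  recip-antitone {p} {q} p>0 q>0 p≤q = begin
      recip q q>0                                ≡⟨ ℚₚ.*-identityˡ (recip q q>0) ⟨
      1ℚ ℚ.* recip q q>0                         ≡⟨ cong (ℚ._* recip q q>0) (recip-inverse p p>0) ⟨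
      p ℚ.* recip p p>0 ℚ.* recip q q>0          ≡⟨ shuffle p (recip p p>0) (recip q q>0) ⟩
      p ℚ.* (recip p p>0 ℚ.* recip q q>0)        ≤⟨ ℚₚ.*-monoʳ-≤-nonNeg _
          {{ℚ.nonNegative (ℚₚ.<⇒≤ (pos* (recip>0 p p>0) (recip>0 q q>0)))}} p≤q ⟩
      q ℚ.* (recip p p>0 ℚ.* recip q q>0)        ≡⟨ shuffle′ q (recip p p>0) (recip q q>0) ⟩
      q ℚ.* recip q q>0 ℚ.* recip p p>0          ≡⟨ cong (ℚ._* recip p p>0) (recip-inverse q q>0) ⟩
      1ℚ ℚ.* recip p p>0                         ≡⟨ ℚₚ.*-identityˡ (recip p p>0) ⟩
      recip p p>0                                ∎
    where
    open +-*-Solver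
    shuffle : ∀ p r s → p ℚ.* r ℚ.* s ≡ p ℚ.* (r ℚ.* s)
    shuffle = ℚₚ.*-assoc
    shuffle′ : ∀ q r s → q ℚ.* (r ℚ.* s) ≡ q ℚ.* s ℚ.* r
    shuffle′ = solve 3 (λ q r s → q :* (r :* s) := q :* s :* r) refl

  recip-cauchy : ∀ {a} → IsCauchy a → ∀ δ → (δ>0 : 0ℚ ℚ.< δ) → (δ≤a : ∀ n → δ ℚ.≤ a n) →
    IsCauchy (λ n → recip (a n) (ℚₚ.<-≤-trans δ>0 (δ≤a n)))
  recip-cauchy {a} ca δ δ>0 δ≤a ε ε>0 with ca (ε ℚ.* (δ ℚ.* δ)) (pos* ε>0 (pos* δ>0 δ>0))
  ... | N , near = N , λ m n p q → begin
      ℚ.∣ r m ℚ.- r n ∣                                      ≡⟨ cong ℚ.∣_∣ (cross m n) ⟩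
      ℚ.∣ (a n ℚ.- a m) ℚ.* (r m ℚ.* r n) ∣                  ≡⟨ ℚₚ.∣p*q∣≡∣p∣*∣q∣ (a n ℚ.- a m) (r m ℚ.* r n) ⟩
      ℚ.∣ a n ℚ.- a m ∣ ℚ.* ℚ.∣ r m ℚ.* r n ∣                ≡⟨ cong (ℚ.∣ a n ℚ.- a m ∣ ℚ.*_)
          (ℚₚ.0≤p⇒∣p∣≡p (ℚₚ.<⇒≤ (pos* (r>0 m) (r>0 n)))) ⟩
      ℚ.∣ a n ℚ.- a m ∣ ℚ.* (r m ℚ.* r n)                    ≤⟨ *-mono-≤
          (ℚₚ.<⇒≤ (pos* (r>0 m) (r>0 n))) (ℚₚ.<⇒≤ (pos* ε>0 (pos* δ>0 δ>0))) (near n m q p)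
          (*-mono-≤ (ℚₚ.<⇒≤ (r>0 n)) (ℚₚ.<⇒≤ (recip>0 δ δ>0)) (r≤ m) (r≤ n)) ⟩
      ε ℚ.* (δ ℚ.* δ) ℚ.* (recip δ δ>0 ℚ.* recip δ δ>0)      ≡⟨ regroup ε δ (recip δ δ>0) ⟩
      ε ℚ.* ((δ ℚ.* recip δ δ>0) ℚ.* (δ ℚ.* recip δ δ>0))    ≡⟨ cong (λ t → ε ℚ.* (t ℚ.* t)) (recip-inverse δ δ>0) ⟩
      ε ℚ.* 1ℚ                                               ≡⟨ ℚₚ.*-identityʳ ε ⟩
      ε                                                      ∎
    where
    open +-*-Solver
    a>0 : ∀ n → 0ℚ ℚ.< a n
    a>0 n = ℚₚ.<-≤-trans δ>0 (δ≤a n)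
    r : ℕ → ℚ
    r n = recip (a n) (a>0 n)
    r>0 : ∀ n → 0ℚ ℚ.< r n
    r>0 n = recip>0 (a n) (a>0 n)
    r≤ : ∀ n → r n ℚ.≤ recip δ δ>0
    r≤ n = recip-antitone δ>0 (a>0 n) (δ≤a n)
    regroup : ∀ e d s → e ℚ.* (d ℚ.* d) ℚ.* (s ℚ.* s) ≡ e ℚ.* ((d ℚ.* s) ℚ.* (d ℚ.* s))
    regroup = solve 3 (λ e d s → e :* (d :* d) :* (s :* s) := e :* ((d :* s) :* (d :* s))) refl
    expand : ∀ p q s t → (q ℚ.- p) ℚ.* (s ℚ.* t) ≡ s ℚ.* (q ℚ.* t) ℚ.- t ℚ.* (p ℚ.* s)
    expand = solve 4 (λ p q s t → (q :- p) :* (s :* t) := s :* (q :* t) :- t :* (p :* s)) refl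
    cross : ∀ m n → r m ℚ.- r n ≡ (a n ℚ.- a m) ℚ.* (r m ℚ.* r n)
    cross m n = sym (trans (expand (a m) (a n) (r m) (r n)) (cong₂ ℚ._-_
      (trans (cong (r m ℚ.*_) (recip-inverse (a n) (a>0 n))) (ℚₚ.*-identityʳ (r m)))
      (trans (cong (r n ℚ.*_) (recip-inverse (a m) (a>0 m))) (ℚₚ.*-identityʳ (r n)))))

  shift-cauchy : ∀ {a} k → IsCauchy a → IsCauchy (λ n → a (k ℕ.+ n))
  shift-cauchy k ca ε ε>0 with ca ε ε>0
  ... | N , near = N , λ m n p q →
    near (k ℕ.+ m) (k ℕ.+ n) (ℕₚ.≤-trans p (ℕₚ.m≤n+m m k)) (ℕₚ.≤-trans q (ℕₚ.m≤n+m n k))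

open CauchyLemmas

infixl 7 _*_ _/_[_]
infixl 6 _+_ _-_
infix  8 -_
infix  9 _²

fromℚ : ℚ → ℝ
seq    (fromℚ q) n = q
cauchy (fromℚ q) ε ε>0 = 0 , λ _ _ _ _ →
  ℚₚ.≤-trans (ℚₚ.≤-reflexive (cong ℚ.∣_∣ (ℚₚ.+-inverseʳ q))) (ℚₚ.<⇒≤ ε>0)

1ℝ 2ℝ ½ℝ : ℝ
1ℝ = fromℚ 1ℚ
2ℝ = fromℚ (1ℚ ℚ.+ 1ℚ)
½ℝ = fromℚ ½

_+_ : ℝ → ℝ → ℝ
seq    (x + y) n = seq x n ℚ.+ seq y n
cauchy (x + y)   = +-cauchy {seq x} {seq y} (cauchy x) (cauchy y)

_*_ : ℝ → ℝ → ℝ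
seq    (x * y) n = seq x n ℚ.* seq y n
cauchy (x * y)   = *-cauchy {seq x} {seq y} (cauchy x) (cauchy y)

-_ : ℝ → ℝ
seq    (- x) n = ℚ.- seq x n
cauchy (- x)   = neg-cauchy {seq x} (cauchy x)

_-_ : ℝ → ℝ → ℝ
x - y = x + (- y)

_² : ℝ → ℝ
x ² = x * x

*-positive : ∀ {x y} → Positive x → Positive y → Positive (x * y)
*-positive (mkPositive p p>0 M p≤) (mkPositive q q>0 N q≤) =
  mkPositive (p ℚ.* q) (pos* p>0 q>0) (M ℕ.⊔ N) λ n M⊔N≤n →
    let p≤xₙ = p≤ n (ℕₚ.m⊔n≤o⇒m≤o M N M⊔N≤n)
    in *-mono-≤ (ℚₚ.<⇒≤ q>0) (ℚₚ.≤-trans (ℚₚ.<⇒≤ p>0) p≤xₙ) p≤xₙ (q≤ n (ℕₚ.m⊔n≤o⇒n≤o M N M⊔N≤n))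

-- The sequence is shifted past the index from which all terms are
-- bounded away from zero; this does not change the limit.
recipℝ : ∀ y → Positive y → ℝ
seq (recipℝ y (mkPositive δ δ>0 N δ≤y)) n =
  recip (seq y (N ℕ.+ n)) (ℚₚ.<-≤-trans δ>0 (δ≤y (N ℕ.+ n) (ℕₚ.m≤m+n N n)))
cauchy (recipℝ y (mkPositive δ δ>0 N δ≤y)) =
  recip-cauchy {λ n → seq y (N ℕ.+ n)} (shift-cauchy {seq y} N (cauchy y))
    δ δ>0 (λ n → δ≤y (N ℕ.+ n) (ℕₚ.m≤m+n N n))

_/_[_] : ∀ (x y : ℝ) → Positive y → ℝ
x / y [ y>0 ] = x * recipℝ y y>0

IsPositiveSqrt : ℝ → ℝ → Set
IsPositiveSqrt r d = Positive r × r ² ≈ d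

∏ : ∀ {A : Set} → List A → (A → ℝ) → ℝ
∏ xs f = foldr (λ a p → f a * p) 1ℝ xs

Point : Set
Point = ℤ × ℤ × ℤ

Bit Bit² Bit³ : Set
Bit  = Bool
Bit² = Bit × Bit
Bit³ = Bit × Bit × Bit

pattern O = false
pattern I = true

⟦_⟧ : Bit → ℤ
⟦ O ⟧ = 0ℤ
⟦ I ⟧ = 1ℤ

infixl 6 _⊕_ _⊖_

_⊕_ _⊖_ : Point → Bit³ → Point
(a , b , c) ⊕ (i , j , k) = a ℤ.+ ⟦ i ⟧ , b ℤ.+ ⟦ j ⟧ , c ℤ.+ ⟦ k ⟧
(a , b , c) ⊖ (i , j , k) = a ℤ.- ⟦ i ⟧ , b ℤ.- ⟦ j ⟧ , c ℤ.- ⟦ k ⟧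

record UnitCube : Set where
  constructor cube
  field
    minCorner : Point

cubeVertex : UnitCube → Bit³ → Point
cubeVertex (cube p) u = p ⊕ u

-- A unit square is given by its minimal vertex and its normal direction.
record UnitSquare : Set where
  constructor square
  field
    normal    : Fin 3
    minCorner : Point

inPlane : Fin 3 → Bit² → Bit³
inPlane zero             (i , j) = O , i , j
inPlane (suc zero)       (i , j) = i , O , j
inPlane (suc (suc zero)) (i , j) = i , j , O

squareVertex : UnitSquare → Bit² → Point
squareVertex (square d p) u = p ⊕ inPlane d u

bits : List Bit
bits = O ∷ I ∷ []

bits² : List Bit²
bits² = cartesianProduct bits bits

bits³ : List Bit³
bits³ = cartesianProduct bits bits²

axes : List (Fin 3)
axes = zero ∷ suc zero ∷ suc (suc zero) ∷ []

-- Each cube (square) containing v is listed together with the position of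
-- v among its vertices; see ∈-cubesAt and ∈-squaresAt below.
cubeAt : Point → Bit³ → UnitCube × Bit³
cubeAt v u = cube (v ⊖ u) , u

cubesAt : Point → List (UnitCube × Bit³)
cubesAt v = map (cubeAt v) bits³

squareAt : Point → Fin 3 × Bit² → UnitSquare × Bit²
squareAt v (d , u) = square d (v ⊖ inPlane d u) , u

squaresAt : Point → List (UnitSquare × Bit²)
squaresAt v = map (squareAt v) (cartesianProduct axes bits²)

private
  ⊖⊕ : ∀ v u → v ⊖ u ⊕ u ≡ v
  ⊖⊕ (a , b , c) (i , j , k) = cong₂ _,_ (lem a i) (cong₂ _,_ (lem b j) (lem c k))
    where
    lem : ∀ a i → (a ℤ.- ⟦ i ⟧) ℤ.+ ⟦ i ⟧ ≡ a
    lem a i = trans (ℤₚ.+-assoc a (ℤ.- ⟦ i ⟧) ⟦ i ⟧)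
                (trans (cong (λ t → a ℤ.+ t) (ℤₚ.+-inverseˡ ⟦ i ⟧)) (ℤₚ.+-identityʳ a))

  ⊕⊖ : ∀ v u → v ⊕ u ⊖ u ≡ v
  ⊕⊖ (a , b , c) (i , j , k) = cong₂ _,_ (lem a i) (cong₂ _,_ (lem b j) (lem c k))
    where
    lem : ∀ a i → (a ℤ.+ ⟦ i ⟧) ℤ.- ⟦ i ⟧ ≡ a
    lem a i = trans (ℤₚ.+-assoc a ⟦ i ⟧ (ℤ.- ⟦ i ⟧))
                (trans (cong (λ t → a ℤ.+ t) (ℤₚ.+-inverseʳ ⟦ i ⟧)) (ℤₚ.+-identityʳ a))

  ∈-bits : ∀ i → i ∈ bits
  ∈-bits O = here refl
  ∈-bits I = there (here refl)

  ∈-bits² : ∀ u → u ∈ bits²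
  ∈-bits² (i , j) = ∈-cartesianProduct⁺ (∈-bits i) (∈-bits j)

  ∈-bits³ : ∀ u → u ∈ bits³
  ∈-bits³ (i , u) = ∈-cartesianProduct⁺ (∈-bits i) (∈-bits² u)

  ∈-axes : ∀ d → d ∈ axes
  ∈-axes zero             = here refl
  ∈-axes (suc zero)       = there (here refl)
  ∈-axes (suc (suc zero)) = there (there (here refl))

  bits-unique : Unique bits
  bits-unique = ((λ ()) ∷ []) ∷ [] ∷ []

  axes-unique : Unique axes
  axes-unique = ((λ ()) ∷ (λ ()) ∷ []) ∷ ((λ ()) ∷ []) ∷ [] ∷ []

∈-cubesAt : ∀ v C u → ((C , u) ∈ cubesAt v) ⇔ (cubeVertex C u ≡ v)
∈-cubesAt v C u = mk⇔ to from
  where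
  to : ∀ {C u} → (C , u) ∈ cubesAt v → cubeVertex C u ≡ v
  to C∈ with ∈-map⁻ (cubeAt v) C∈
  ... | u′ , _ , refl = ⊖⊕ v u′
  from : ∀ {C u} → cubeVertex C u ≡ v → (C , u) ∈ cubesAt v
  from {cube p} {u} refl = subst (λ q → (cube q , u) ∈ cubesAt (p ⊕ u)) (⊕⊖ p u)
    (∈-map⁺ (cubeAt (p ⊕ u)) (∈-bits³ u))

∈-squaresAt : ∀ v S u → ((S , u) ∈ squaresAt v) ⇔ (squareVertex S u ≡ v)
∈-squaresAt v S u = mk⇔ to from
  where
  to : ∀ {S u} → (S , u) ∈ squaresAt v → squareVertex S u ≡ v
  to S∈ with ∈-map⁻ (squareAt v) S∈
  ... | (d , u′) , _ , refl = ⊖⊕ v (inPlane d u′)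
  from : ∀ {S u} → squareVertex S u ≡ v → (S , u) ∈ squaresAt v
  from {square d p} {u} refl = subst (λ q → (square d q , u) ∈ squaresAt (p ⊕ inPlane d u)) (⊕⊖ p (inPlane d u))
    (∈-map⁺ (squareAt (p ⊕ inPlane d u)) (∈-cartesianProduct⁺ (∈-axes d) (∈-bits² u)))

cubesAt-unique : ∀ v → Unique (cubesAt v)
cubesAt-unique v = Unique.map⁺ {f = cubeAt v} (cong proj₂)
  (Unique.cartesianProduct⁺ bits-unique (Unique.cartesianProduct⁺ bits-unique bits-unique))

squaresAt-unique : ∀ v → Unique (squaresAt v)
squaresAt-unique v = Unique.map⁺ {f = squareAt v} (cong (λ (S , u) → UnitSquare.normal S , u))
  (Unique.cartesianProduct⁺ axes-unique (Unique.cartesianProduct⁺ bits-unique bits-unique))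

cubesAt-length : ∀ v → length (cubesAt v) ≡ 8
cubesAt-length v = refl

squaresAt-length : ∀ v → length (squaresAt v) ≡ 12
squaresAt-length v = refl

-- The cube is identified with {0,1}³ by reflecting the position u of the
-- distinguished vertex to 000.
K : (Point → ℝ) → UnitCube × Bit³ → ℝ
K x (C , (a , b , c)) =
  ½ℝ * (z I I I * z O O O ² - z O O O * (z I O O * z O I I + z O I O * z I O I + z O O I * z I I O))
    - z I O O * z O I O * z O O I
  where
  z : Bit → Bit → Bit → ℝ
  z i j k = x (cubeVertex C (a xor i , b xor j , c xor k))

squareFactor : (Point → ℝ) → UnitSquare × Bit² → ℝ
squareFactor x (S , (a , b)) = x v * x v₂ + x v₁ * x v₃
  where
  v v₁ v₂ v₃ : Point
  v  = squareVertex S (a , b)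
  v₁ = squareVertex S (not a , b)
  v₂ = squareVertex S (not a , not b)
  v₃ = squareVertex S (a , not b)

PositiveKashaev : (x : Point → ℝ) → (∀ s → Positive (x s)) → Set
PositiveKashaev x x>0 = ∀ (v : Point) →
  let z : Bit → Bit → Bit → ℝ
      z i j k = x (v ⊕ (i , j , k))
      z₀₀₀>0 = x>0 (v ⊕ (O , O , O))
      A = 2ℝ * z I O O * z O I O * z O O I
          + z O O O * (z I O O * z O I I + z O I O * z I O I + z O O I * z I I O)
      D = (z O O O * z O I I + z O I O * z O O I)
          * (z O O O * z I O I + z I O O * z O O I)
          * (z O O O * z I I O + z I O O * z O I O)
  in Σ ℝ λ √D → IsPositiveSqrt √D D ×
     z I I I ≈ (A + 2ℝ * √D) / z O O O ² [ *-positive z₀₀₀>0 z₀₀₀>0 ]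

{-# OPTIONS --safe #-}

-- For a cube with values z, write K_u for the Kashaev polynomial at the vertex u and D_u for
-- the product of the square factors of the three faces at u.  Then 4 (K_u² − D_u) = z_u² H,
-- where H (the 2×2×2 hyperdeterminant up to the signs of z₀₀₀z₀₁₁z₁₀₁z₁₁₀ and z₁₁₁z₁₀₀z₀₁₀z₀₀₁)
-- is invariant under the symmetries of the cube.  The recurrence says K₀₀₀ = √D₀₀₀, so H = 0
-- and K_u² = D_u at all eight vertices.  It also gives, after clearing z₀₀₀, explicit
-- polynomials with positive coefficients in the z's and √D₀₀₀ for K₁₁₁ and for −K_u at the six
-- remaining vertices.  A vertex v occupies each of the eight positions in exactly one of the
-- cubes containing it, and each square at v lies on two of these cubes, so the two sides of
-- the theorem are positive (six negative factors) and have equal squares.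

module Submission where

open import Algebra.Bundles using (CommutativeRing)
open import Algebra.Bundles.Raw using (RawRing)
import Algebra.Solver.Ring
open import Algebra.Solver.Ring.AlmostCommutativeRing using (fromCommutativeRing; _-Raw-AlmostCommutative⟶_)
open import Data.Bool.Base using (_xor_)
open import Data.Fin.Base using (Fin)
open import Data.Fin.Patterns using (0F; 1F; 2F; 3F; 4F; 5F; 6F; 7F; 8F)
open import Data.Integer.Base as ℤ using (ℤ)
import Data.Integer.Properties as ℤₚ
open import Data.List.Base using ([]; _∷_; cartesianProduct)
import Data.Maybe.Base as Maybe
open import Data.Nat.Base as ℕ using (ℕ)
import Data.Nat.Properties as ℕₚ
open import Data.Product.Base using (_×_; _,_; proj₁; proj₂)
open import Data.Rational.Base as ℚ using (ℚ; 0ℚ; 1ℚ; ½)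
import Data.Rational.Properties as ℚₚ
open import Data.Rational.Solver using (module +-*-Solver)
open import Data.Sum.Base using (inj₁; inj₂)
open import Data.Vec.Base using (Vec; []; _∷_)
open import Level using (0ℓ)
open import Relation.Binary.PropositionalEquality using (_≡_; refl; cong; cong₂; sym; trans)
open import Relation.Binary.Structures using (IsEquivalence)
open import Relation.Nullary.Decidable using (dec⇒maybe)

open import Defs
open CauchyLemmas
open _≈_

-- The ordered field of real numbers

seq-≡⇒≈ : ∀ {x y} → (∀ n → seq x n ≡ seq y n) → x ≈ y
close (seq-≡⇒≈ {x} {y} eq) ε ε>0 = 0 , λ n _ →
  ℚₚ.≤-trans (ℚₚ.≤-reflexive (cong ℚ.∣_∣ (trans (cong (ℚ._- seq y n) (eq n)) (ℚₚ.+-inverseʳ (seq y n))))) (ℚₚ.<⇒≤ ε>0)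

≈-refl : ∀ {x} → x ≈ x
≈-refl = seq-≡⇒≈ λ _ → refl

p≤∣p∣ : ∀ p → p ℚ.≤ ℚ.∣ p ∣
p≤∣p∣ p with ℚₚ.≤-total 0ℚ p
... | inj₁ 0≤p = ℚₚ.≤-reflexive (sym (ℚₚ.0≤p⇒∣p∣≡p 0≤p))
... | inj₂ p≤0 = ℚₚ.≤-trans p≤0 (ℚₚ.0≤∣p∣ p)

≈-sym : ∀ {x y} → x ≈ y → y ≈ x
close (≈-sym {x} {y} x≈y) ε ε>0 with close x≈y ε ε>0
... | N , near = N , λ n N≤n → ℚₚ.≤-trans (ℚₚ.≤-reflexive (flip (seq y n) (seq x n))) (near n N≤n)
  where
  open +-*-Solver
  flip : ∀ p q → ℚ.∣ p ℚ.- q ∣ ≡ ℚ.∣ q ℚ.- p ∣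
  flip p q = trans (cong ℚ.∣_∣ (solve 2 (λ p q → p :- q := :- (q :- p)) refl p q)) (ℚₚ.∣-p∣≡∣p∣ (q ℚ.- p))

module _ where
  open ℚₚ.≤-Reasoning

  ∣p+q∣≤ε : ∀ ε p q → ℚ.∣ p ∣ ℚ.≤ ε ℚ.* ½ → ℚ.∣ q ∣ ℚ.≤ ε ℚ.* ½ → ℚ.∣ p ℚ.+ q ∣ ℚ.≤ ε
  ∣p+q∣≤ε ε p q p≤ q≤ = begin
    ℚ.∣ p ℚ.+ q ∣          ≤⟨ ℚₚ.∣p+q∣≤∣p∣+∣q∣ p q ⟩
    ℚ.∣ p ∣ ℚ.+ ℚ.∣ q ∣    ≤⟨ ℚₚ.+-mono-≤ p≤ q≤ ⟩
    ε ℚ.* ½ ℚ.+ ε ℚ.* ½    ≡⟨ half+half ε ⟩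
    ε                      ∎

  ≈-trans : ∀ {x y z} → x ≈ y → y ≈ z → x ≈ z
  close (≈-trans {x} {y} {z} x≈y y≈z) ε ε>0
    with close x≈y (ε ℚ.* ½) (half ε>0) | close y≈z (ε ℚ.* ½) (half ε>0)
  ... | M , near-xy | N , near-yz = M ℕ.⊔ N , λ n p → begin
      ℚ.∣ seq x n ℚ.- seq z n ∣                                  ≡⟨ cong ℚ.∣_∣ (split (seq x n) (seq y n) (seq z n)) ⟩
      ℚ.∣ (seq x n ℚ.- seq y n) ℚ.+ (seq y n ℚ.- seq z n) ∣      ≤⟨ ∣p+q∣≤ε ε (seq x n ℚ.- seq y n) (seq y n ℚ.- seq z n)
          (near-xy n (ℕₚ.m⊔n≤o⇒m≤o M N p)) (near-yz n (ℕₚ.m⊔n≤o⇒n≤o M N p)) ⟩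
      ε                                                          ∎
    where
    open +-*-Solver
    split : ∀ p q r → p ℚ.- r ≡ (p ℚ.- q) ℚ.+ (q ℚ.- r)
    split = solve 3 (λ p q r → p :- r := (p :- q) :+ (q :- r)) refl

  +-cong : ∀ {x x′ y y′} → x ≈ x′ → y ≈ y′ → x + y ≈ x′ + y′
  close (+-cong {x} {x′} {y} {y′} x≈x′ y≈y′) ε ε>0
    with close x≈x′ (ε ℚ.* ½) (half ε>0) | close y≈y′ (ε ℚ.* ½) (half ε>0)
  ... | M , near-x | N , near-y = M ℕ.⊔ N , λ n p → begin
      ℚ.∣ (seq x n ℚ.+ seq y n) ℚ.- (seq x′ n ℚ.+ seq y′ n) ∣    ≡⟨ cong ℚ.∣_∣ (swap (seq x n) (seq y n) (seq x′ n) (seq y′ n)) ⟩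
      ℚ.∣ (seq x n ℚ.- seq x′ n) ℚ.+ (seq y n ℚ.- seq y′ n) ∣    ≤⟨ ∣p+q∣≤ε ε (seq x n ℚ.- seq x′ n) (seq y n ℚ.- seq y′ n)
          (near-x n (ℕₚ.m⊔n≤o⇒m≤o M N p)) (near-y n (ℕₚ.m⊔n≤o⇒n≤o M N p)) ⟩
      ε                                                          ∎
    where
    open +-*-Solver
    swap : ∀ p q r s → (p ℚ.+ q) ℚ.- (r ℚ.+ s) ≡ (p ℚ.- r) ℚ.+ (q ℚ.- s)
    swap = solve 4 (λ p q r s → (p :+ q) :- (r :+ s) := (p :- r) :+ (q :- s)) refl

  -‿cong : ∀ {x y} → x ≈ y → - x ≈ - y
  close (-‿cong {x} {y} x≈y) ε ε>0 with close x≈y ε ε>0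
  ... | N , near = N , λ n N≤n → begin
      ℚ.∣ ℚ.- seq x n ℚ.- ℚ.- seq y n ∣    ≡⟨ cong ℚ.∣_∣ (ℚₚ.neg-distrib-+ (seq x n) (ℚ.- seq y n)) ⟨
      ℚ.∣ ℚ.- (seq x n ℚ.- seq y n) ∣      ≡⟨ ℚₚ.∣-p∣≡∣p∣ (seq x n ℚ.- seq y n) ⟩
      ℚ.∣ seq x n ℚ.- seq y n ∣            ≤⟨ near n N≤n ⟩
      ε                                    ∎

  *-congʳ : ∀ {x x′} y → x ≈ x′ → x * y ≈ x′ * y
  close (*-congʳ {x} {x′} y x≈x′) ε ε>0 = M ℕ.⊔ N , λ n p → begin
      ℚ.∣ seq x n ℚ.* seq y n ℚ.- seq x′ n ℚ.* seq y n ∣    ≡⟨ cong ℚ.∣_∣ (factor (seq x n) (seq x′ n) (seq y n)) ⟩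
      ℚ.∣ (seq x n ℚ.- seq x′ n) ℚ.* seq y n ∣              ≤⟨ *-bound ε B (seq x n ℚ.- seq x′ n) (seq y n) ε>0 B>0
          (near n (ℕₚ.m⊔n≤o⇒n≤o M N p)) (y≤B n (ℕₚ.m⊔n≤o⇒m≤o M N p)) ⟩
      ε                                                     ∎
    where
    open +-*-Solver
    bound-y = bounded {seq y} (cauchy y)
    B = proj₁ bound-y
    B>0 = proj₁ (proj₂ bound-y)
    M = proj₁ (proj₂ (proj₂ bound-y))
    y≤B = proj₂ (proj₂ (proj₂ bound-y))
    close-x = close x≈x′ (ε ℚ.* recip B B>0) (pos* ε>0 (recip>0 B B>0))
    N = proj₁ close-x
    near = proj₂ close-x
    factor : ∀ p q r → p ℚ.* r ℚ.- q ℚ.* r ≡ (p ℚ.- q) ℚ.* r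
    factor = solve 3 (λ p q r → p :* r :- q :* r := (p :- q) :* r) refl

*-comm : ∀ x y → x * y ≈ y * x
*-comm x y = seq-≡⇒≈ λ n → ℚₚ.*-comm (seq x n) (seq y n)

*-cong : ∀ {x x′ y y′} → x ≈ x′ → y ≈ y′ → x * y ≈ x′ * y′
*-cong {x} {x′} {y} {y′} x≈x′ y≈y′ = ≈-trans (*-congʳ y x≈x′)
  (≈-trans (*-comm x′ y) (≈-trans (*-congʳ x′ y≈y′) (*-comm y′ x′)))

0ℝ : ℝ
0ℝ = fromℚ 0ℚ

-- The commutative ring of real numbers and its polynomial solver

≈-isEquivalence : IsEquivalence _≈_
≈-isEquivalence = record { refl = ≈-refl ; sym = ≈-sym ; trans = ≈-trans }

ℝ-commutativeRing : CommutativeRing 0ℓ 0ℓ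
ℝ-commutativeRing = record
  { Carrier = ℝ ; _≈_ = _≈_ ; _+_ = _+_ ; _*_ = _*_ ; -_ = -_ ; 0# = 0ℝ ; 1# = 1ℝ
  ; isCommutativeRing = record
    { isRing = record
      { +-isAbelianGroup = record
        { isGroup = record
          { isMonoid = record
            { isSemigroup = record
              { isMagma = record { isEquivalence = ≈-isEquivalence ; ∙-cong = +-cong }
              ; assoc = λ x y z → seq-≡⇒≈ λ n → ℚₚ.+-assoc (seq x n) (seq y n) (seq z n)
              }
            ; identity = (λ x → seq-≡⇒≈ λ n → ℚₚ.+-identityˡ (seq x n))
                       , (λ x → seq-≡⇒≈ λ n → ℚₚ.+-identityʳ (seq x n))
            }
          ; inverse = (λ x → seq-≡⇒≈ λ n → ℚₚ.+-inverseˡ (seq x n))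
                    , (λ x → seq-≡⇒≈ λ n → ℚₚ.+-inverseʳ (seq x n))
          ; ⁻¹-cong = -‿cong
          }
        ; comm = λ x y → seq-≡⇒≈ λ n → ℚₚ.+-comm (seq x n) (seq y n)
        }
      ; *-cong = *-cong
      ; *-assoc = λ x y z → seq-≡⇒≈ λ n → ℚₚ.*-assoc (seq x n) (seq y n) (seq z n)
      ; *-identity = (λ x → seq-≡⇒≈ λ n → ℚₚ.*-identityˡ (seq x n))
                   , (λ x → seq-≡⇒≈ λ n → ℚₚ.*-identityʳ (seq x n))
      ; distrib = (λ x y z → seq-≡⇒≈ λ n → ℚₚ.*-distribˡ-+ (seq x n) (seq y n) (seq z n))
                , (λ x y z → seq-≡⇒≈ λ n → ℚₚ.*-distribʳ-+ (seq x n) (seq y n) (seq z n))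
      }
    ; *-comm = *-comm
    }
  }

open CommutativeRing ℝ-commutativeRing using (setoid; reflexive; +-identityˡ; +-identityʳ; -‿inverseʳ; *-congˡ; *-identityˡ; zeroʳ)
import Relation.Binary.Reasoning.Setoid setoid as ≈-Reasoning

-- Rational coefficients let the solver treat the `½` in `K` as a constant, and their equality is
-- decidable.
fromℚ-homomorphism : CommutativeRing.rawRing ℚₚ.+-*-commutativeRing -Raw-AlmostCommutative⟶ fromCommutativeRing ℝ-commutativeRing
fromℚ-homomorphism = record
  { ⟦_⟧    = fromℚ
  ; +-homo = λ _ _ → seq-≡⇒≈ λ _ → refl
  ; *-homo = λ _ _ → seq-≡⇒≈ λ _ → refl
  ; -‿homo = λ _ → seq-≡⇒≈ λ _ → refl
  ; 0-homo = ≈-refl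
  ; 1-homo = ≈-refl
  }

module ℝ-Solver = Algebra.Solver.Ring
  (CommutativeRing.rawRing ℚₚ.+-*-commutativeRing) (fromCommutativeRing ℝ-commutativeRing) fromℚ-homomorphism
  (λ p q → Maybe.map (λ p≡q → seq-≡⇒≈ λ _ → p≡q) (dec⇒maybe (p ℚₚ.≟ q)))

-- Positivity, reciprocals and cancellation

fromℚ-positive : ∀ {q} → 0ℚ ℚ.< q → Positive (fromℚ q)
fromℚ-positive {q} q>0 = mkPositive q q>0 0 λ _ _ → ℚₚ.≤-refl

+-positive : ∀ {x y} → Positive x → Positive y → Positive (x + y)
+-positive (mkPositive p p>0 M p≤) (mkPositive q q>0 N q≤) =
  mkPositive (p ℚ.+ q) (ℚₚ.+-mono-< p>0 q>0) (M ℕ.⊔ N) λ n M⊔N≤n →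
    ℚₚ.+-mono-≤ (p≤ n (ℕₚ.m⊔n≤o⇒m≤o M N M⊔N≤n)) (q≤ n (ℕₚ.m⊔n≤o⇒n≤o M N M⊔N≤n))

-- Once the two sequences are within `p`/2 of each other, half of the lower bound survives.
Positive-resp-≈ : ∀ {x y} → x ≈ y → Positive x → Positive y
Positive-resp-≈ {x} {y} x≈y (mkPositive p p>0 M p≤) with close x≈y (p ℚ.* ½) (half p>0)
... | N , near = mkPositive (p ℚ.* ½) (half p>0) (M ℕ.⊔ N) λ n M⊔N≤n → begin
    p ℚ.* ½                                          ≡⟨ halve p ⟩
    p ℚ.- p ℚ.* ½                                    ≤⟨ ℚₚ.+-mono-≤ (p≤ n (ℕₚ.m⊔n≤o⇒m≤o M N M⊔N≤n))
        (ℚₚ.neg-antimono-≤ (ℚₚ.≤-trans (p≤∣p∣ (seq x n ℚ.- seq y n)) (near n (ℕₚ.m⊔n≤o⇒n≤o M N M⊔N≤n)))) ⟩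
    seq x n ℚ.- (seq x n ℚ.- seq y n)                ≡⟨ cancel (seq x n) (seq y n) ⟩
    seq y n                                          ∎
  where
  open ℚₚ.≤-Reasoning
  open +-*-Solver
  halve : ∀ p → p ℚ.* ½ ≡ p ℚ.- p ℚ.* ½
  halve = solve 1 (λ p → p :* con ½ := p :- p :* con ½) refl
  cancel : ∀ p q → p ℚ.- (p ℚ.- q) ≡ q
  cancel = solve 2 (λ p q → p :- (p :- q) := q) refl

-- The reciprocal sequence runs `M` terms ahead of `y`, so the product is not termwise 1. The Cauchy
-- property controls `seq y n` - `seq y (M + n)`, and the reciprocals are at most 1/`δ`.
recipℝ-inverse : ∀ y (y>0 : Positive y) → y * recipℝ y y>0 ≈ 1ℝ
close (recipℝ-inverse y (mkPositive δ δ>0 M δ≤y)) ε ε>0 = N , λ n N≤n → begin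
    ℚ.∣ seq y n ℚ.* r n ℚ.- 1ℚ ∣                          ≡⟨ cong (λ t → ℚ.∣ seq y n ℚ.* r n ℚ.- t ∣)
        (recip-inverse (seq y (M ℕ.+ n)) (y>0 n)) ⟨
    ℚ.∣ seq y n ℚ.* r n ℚ.- seq y (M ℕ.+ n) ℚ.* r n ∣     ≡⟨ cong ℚ.∣_∣ (factor (seq y n) (seq y (M ℕ.+ n)) (r n)) ⟩
    ℚ.∣ (seq y n ℚ.- seq y (M ℕ.+ n)) ℚ.* r n ∣           ≤⟨ *-bound ε (recip δ δ>0) (seq y n ℚ.- seq y (M ℕ.+ n)) (r n)
        ε>0 (recip>0 δ δ>0) (near n (M ℕ.+ n) N≤n (ℕₚ.≤-trans N≤n (ℕₚ.m≤n+m n M))) (∣r∣≤ n) ⟩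
    ε                                                     ∎
  where
  open ℚₚ.≤-Reasoning
  open +-*-Solver
  cauchy-y = cauchy y (ε ℚ.* recip (recip δ δ>0) (recip>0 δ δ>0)) (pos* ε>0 (recip>0 (recip δ δ>0) (recip>0 δ δ>0)))
  N = proj₁ cauchy-y
  near = proj₂ cauchy-y
  y>0 : ∀ n → 0ℚ ℚ.< seq y (M ℕ.+ n)
  y>0 n = ℚₚ.<-≤-trans δ>0 (δ≤y (M ℕ.+ n) (ℕₚ.m≤m+n M n))
  r : ℕ → ℚ
  r n = recip (seq y (M ℕ.+ n)) (y>0 n)
  ∣r∣≤ : ∀ n → ℚ.∣ r n ∣ ℚ.≤ recip δ δ>0
  ∣r∣≤ n = ℚₚ.≤-trans (ℚₚ.≤-reflexive (ℚₚ.0≤p⇒∣p∣≡p (ℚₚ.<⇒≤ (recip>0 (seq y (M ℕ.+ n)) (y>0 n)))))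
    (recip-antitone δ>0 (y>0 n) (δ≤y (M ℕ.+ n) (ℕₚ.m≤m+n M n)))
  factor : ∀ p q r → p ℚ.* r ℚ.- q ℚ.* r ≡ (p ℚ.- q) ℚ.* r
  factor = solve 3 (λ p q r → p :* r :- q :* r := (p :- q) :* r) refl

-- An eventual upper bound `B` for `y` makes 1/`B` an eventual lower bound for the reciprocals.
recipℝ-positive : ∀ y (y>0 : Positive y) → Positive (recipℝ y y>0)
recipℝ-positive y (mkPositive δ δ>0 M δ≤y) = mkPositive (recip B B>0) (recip>0 B B>0) N λ n N≤n →
  recip-antitone (ℚₚ.<-≤-trans δ>0 (δ≤y (M ℕ.+ n) (ℕₚ.m≤m+n M n))) B>0
    (ℚₚ.≤-trans (p≤∣p∣ (seq y (M ℕ.+ n))) (∣y∣≤B (M ℕ.+ n) (ℕₚ.≤-trans N≤n (ℕₚ.m≤n+m n M))))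
  where
  bound-y = bounded {seq y} (cauchy y)
  B = proj₁ bound-y
  B>0 = proj₁ (proj₂ bound-y)
  N = proj₁ (proj₂ (proj₂ bound-y))
  ∣y∣≤B = proj₂ (proj₂ (proj₂ bound-y))

module _ where
  open ≈-Reasoning
  open ℝ-Solver

  recipℝ-cancel : ∀ {x} (x>0 : Positive x) y → recipℝ x x>0 * (x * y) ≈ y
  recipℝ-cancel {x} x>0 y = begin
    recipℝ x x>0 * (x * y)    ≈⟨ solve 3 (λ r x y → r :* (x :* y) := x :* r :* y) ≈-refl (recipℝ x x>0) x y ⟩
    x * recipℝ x x>0 * y      ≈⟨ *-congʳ y (recipℝ-inverse x x>0) ⟩
    1ℝ * y                    ≈⟨ *-identityˡ y ⟩
    y                         ∎

  /-cancel : ∀ {x} y (y>0 : Positive y) → x / y [ y>0 ] * y ≈ x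
  /-cancel {x} y y>0 = begin
    x * recipℝ y y>0 * y      ≈⟨ solve 3 (λ x r y → x :* r :* y := r :* (y :* x)) ≈-refl x (recipℝ y y>0) y ⟩
    recipℝ y y>0 * (y * x)    ≈⟨ recipℝ-cancel y>0 x ⟩
    x                         ∎

  x*y≈0⇒y≈0 : ∀ {x y} → Positive x → x * y ≈ 0ℝ → y ≈ 0ℝ
  x*y≈0⇒y≈0 {x} {y} x>0 x*y≈0 = begin
    y                         ≈⟨ recipℝ-cancel x>0 y ⟨
    recipℝ x x>0 * (x * y)    ≈⟨ *-congˡ x*y≈0 ⟩
    recipℝ x x>0 * 0ℝ         ≈⟨ zeroʳ (recipℝ x x>0) ⟩
    0ℝ                        ∎

  *-positive⁻ʳ : ∀ {x y} → Positive x → Positive (x * y) → Positive y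
  *-positive⁻ʳ {x} {y} x>0 xy>0 = Positive-resp-≈ (recipℝ-cancel x>0 y) (*-positive (recipℝ-positive x x>0) xy>0)

  x≈y⇒x-y≈0 : ∀ {x y} → x ≈ y → x - y ≈ 0ℝ
  x≈y⇒x-y≈0 {x} {y} x≈y = ≈-trans (+-cong x≈y ≈-refl) (-‿inverseʳ y)

  x-y≈0⇒x≈y : ∀ {x y} → x - y ≈ 0ℝ → x ≈ y
  x-y≈0⇒x≈y {x} {y} x-y≈0 = begin
    x              ≈⟨ solve 2 (λ x y → x := x :- y :+ y) ≈-refl x y ⟩
    x - y + y      ≈⟨ +-cong x-y≈0 ≈-refl ⟩
    0ℝ + y         ≈⟨ +-identityˡ y ⟩
    y              ∎

  -- In (x + y)(x - y) = 0 the first factor is positive, so it can be cancelled.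
  ²-injective : ∀ {x y} → Positive x → Positive y → x ² ≈ y ² → x ≈ y
  ²-injective {x} {y} x>0 y>0 x²≈y² = x-y≈0⇒x≈y (x*y≈0⇒y≈0 (+-positive x>0 y>0) (begin
    (x + y) * (x - y)    ≈⟨ solve 2 (λ x y → (x :+ y) :* (x :- y) := x :* x :- y :* y) ≈-refl x y ⟩
    x ² - y ²            ≈⟨ x≈y⇒x-y≈0 x²≈y² ⟩
    0ℝ                   ∎))

  -- Reduces an equality modulo a relation `e` = 0 to a polynomial identity with an explicit
  -- cofactor `t`, which the solver can check.
  x≈y+t*0⇒x≈y : ∀ {x y t e} → e ≈ 0ℝ → x ≈ y + t * e → x ≈ y
  x≈y+t*0⇒x≈y {x} {y} {t} {e} e≈0 x≈ = begin
    x              ≈⟨ x≈ ⟩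
    y + t * e      ≈⟨ +-cong ≈-refl (*-congˡ e≈0) ⟩
    y + t * 0ℝ     ≈⟨ +-cong ≈-refl (zeroʳ t) ⟩
    y + 0ℝ         ≈⟨ +-identityʳ y ⟩
    y              ∎

-- Kashaev cubes

Cube : Set → Set
Cube A = Bit → Bit → Bit → A

-- Moves the vertex at position `u` to 000, so that formulas based at 000 apply at every vertex.
reflect : ∀ {A} → Bit³ → Cube A → Cube A
reflect (a , b , c) z i j k = z (a xor i) (b xor j) (c xor k)

-- Over an arbitrary raw ring, so that a formula is shared by ℝ and the solver's syntax.
module CubePolynomials (R : RawRing 0ℓ 0ℓ) (fromℚ′ : ℚ → RawRing.Carrier R) where
  open RawRing R using () renaming (Carrier to A; _+_ to infixl 6 _+′_; _*_ to infixl 7 _*′_; -_ to infix 8 -′_)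

  infixl 6 _-′_
  _-′_ : A → A → A
  p -′ q = p +′ -′ q

  two oneHalf : A
  two = fromℚ′ (1ℚ ℚ.+ 1ℚ)
  oneHalf = fromℚ′ ½

  diagonals neighbours remotes kashaevK numeratorA discriminant kashaevForm : Cube A → A
  diagonals z = z I O O *′ z O I I +′ z O I O *′ z I O I +′ z O O I *′ z I I O
  neighbours z = z I O O *′ z O I O *′ z O O I
  remotes z = z O I I *′ z I O I *′ z I I O
  kashaevK z = oneHalf *′ (z I I I *′ (z O O O *′ z O O O) -′ z O O O *′ diagonals z) -′ neighbours z
  numeratorA z = two *′ z I O O *′ z O I O *′ z O O I +′ z O O O *′ diagonals z
  discriminant z = (z O O O *′ z O I I +′ z O I O *′ z O O I)
    *′ (z O O O *′ z I O I +′ z I O O *′ z O O I)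
    *′ (z O O O *′ z I I O +′ z I O O *′ z O I O)
  kashaevForm z = h *′ h +′ t₁ *′ t₁ +′ t₂ *′ t₂ +′ t₃ *′ t₃
      -′ two *′ (h *′ (t₁ +′ t₂ +′ t₃) +′ t₁ *′ t₂ +′ t₂ *′ t₃ +′ t₁ *′ t₃)
      -′ two *′ two *′ (z O O O *′ remotes z +′ z I I I *′ neighbours z)
    where
    -- The products along the four long diagonals of the cube.
    h t₁ t₂ t₃ : A
    h = z O O O *′ z I I I
    t₁ = z I O O *′ z O I I
    t₂ = z O I O *′ z I O I
    t₃ = z O O I *′ z I I O

  -- The recurrence with its denominator cleared, `r` standing for √D.
  recurrenceDefect : Cube A → A → A
  recurrenceDefect z r = z I I I *′ (z O O O *′ z O O O) -′ (numeratorA z +′ two *′ r)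

  -- −z₀₀₀ K at a neighbour of 000, −z₀₀₀ K at a neighbour of 111, and z₀₀₀³ K₁₁₁, written
  -- without subtraction by means of the recurrence and r² = D.
  neighbourValue : (a b b′ b″ c′ c″ r : A) → A
  neighbourValue a b b′ b″ c′ c″ r = b *′ (b *′ b′ *′ b″ +′ a *′ (b′ *′ c′) +′ a *′ (b″ *′ c″) +′ r) +′ a *′ a *′ (c′ *′ c″)

  remoteValue : (a b b′ b″ c c′ c″ d r : A) → A
  remoteValue a b b′ b″ c c′ c″ d r = c *′ (b *′ b′ *′ b″ +′ a *′ (b′ *′ c′) +′ a *′ (b″ *′ c″) +′ r) +′ a *′ (b′ *′ b″ *′ d)

  antipodeValue : Cube A → A → A
  antipodeValue z r = (numeratorA z +′ two *′ r) *′ neighbours z +′ numeratorA z *′ r +′ discriminant z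
      -- This bracket is D - a³c₁c₂c₃, expanded so that the subtracted monomial is simply absent. It
      -- absorbs the negative term of z₀₀₀³ K₁₁₁ using one of the two copies of D = r².
      +′ (a *′ c₁ *′ (a *′ c₂) *′ (b₁ *′ b₂) +′ a *′ c₁ *′ (b₁ *′ b₃) *′ (a *′ c₃ +′ b₁ *′ b₂)
          +′ b₂ *′ b₃ *′ (a *′ c₂ +′ b₁ *′ b₃) *′ (a *′ c₃ +′ b₁ *′ b₂))
    where
    a b₁ b₂ b₃ c₁ c₂ c₃ : A
    a = z O O O
    b₁ = z I O O
    b₂ = z O I O
    b₃ = z O O I
    c₁ = z O I I
    c₂ = z I O I
    c₃ = z I I O

open CubePolynomials (CommutativeRing.rawRing ℝ-commutativeRing) fromℚ

module Symbolic where
  open ℝ-Solver public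

  polynomials : ℕ → RawRing 0ℓ 0ℓ
  polynomials n = record
    { Carrier = Polynomial n ; _≈_ = _≡_ ; _+_ = _:+_ ; _*_ = _:*_ ; -_ = :-_ ; 0# = con 0ℚ ; 1# = con 1ℚ }

  module Poly = CubePolynomials (polynomials 9) con

  -- The generic cube; its variables are numbered as in `env`, with `8F` left for the square root.
  Z : Cube (Polynomial 9)
  Z O O O = var 0F
  Z I O O = var 1F
  Z O I O = var 2F
  Z O O I = var 3F
  Z O I I = var 4F
  Z I O I = var 5F
  Z I I O = var 6F
  Z I I I = var 7F

  S : Polynomial 9
  S = var 8F

  env : Cube ℝ → ℝ → Vec ℝ 9
  env z r = z O O O ∷ z I O O ∷ z O I O ∷ z O O I ∷ z O I I ∷ z I O I ∷ z I I O ∷ z I I I ∷ r ∷ []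

open Symbolic using (module Poly; Z; S; env; prove; _:*_; _:+_; :-_; con)

K²-identity : ∀ z → kashaevK z ² ≈ discriminant z + ½ℝ * ½ℝ * z O O O ² * kashaevForm z
K²-identity z = prove (env z 0ℝ) (Poly.kashaevK Z :* Poly.kashaevK Z)
  (Poly.discriminant Z :+ con ½ :* con ½ :* (Z O O O :* Z O O O) :* Poly.kashaevForm Z) ≈-refl

-- A reflection in one coordinate permutes the four diagonal products and exchanges the two
-- inscribed tetrahedra, whose vertex products form the last term. Any `reflect u` is a composite of
-- such reflections.
kashaevForm-reflect : ∀ u z → kashaevForm (reflect u z) ≈ kashaevForm z
kashaevForm-reflect (i , j , k) z = ≈-trans (first i (reflect (O , j , k) z)) (≈-trans (second j (reflect (O , O , k) z)) (third k z))
  where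
  first : ∀ i z → kashaevForm (reflect (i , O , O) z) ≈ kashaevForm z
  first O z = ≈-refl
  first I z = prove (env z 0ℝ) (Poly.kashaevForm (reflect (I , O , O) Z)) (Poly.kashaevForm Z) ≈-refl
  second : ∀ i z → kashaevForm (reflect (O , i , O) z) ≈ kashaevForm z
  second O z = ≈-refl
  second I z = prove (env z 0ℝ) (Poly.kashaevForm (reflect (O , I , O) Z)) (Poly.kashaevForm Z) ≈-refl
  third : ∀ i z → kashaevForm (reflect (O , O , i) z) ≈ kashaevForm z
  third O z = ≈-refl
  third I z = prove (env z 0ℝ) (Poly.kashaevForm (reflect (O , O , I) Z)) (Poly.kashaevForm Z) ≈-refl

orient : Bit³ → ℝ → ℝ
orient (O , O , O) y = y
orient (I , I , I) y = y
orient _           y = - y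

module KashaevCube (z : Cube ℝ) (z>0 : ∀ i j k → Positive (z i j k)) (r : ℝ) (r>0 : Positive r)
  (r²≈D : r ² ≈ discriminant z) (z₁₁₁≈ : z I I I * z O O O ² ≈ numeratorA z + 2ℝ * r) where

  private
    infixl 6 _⟨+⟩_
    _⟨+⟩_ : ∀ {x y} → Positive x → Positive y → Positive (x + y)
    _⟨+⟩_ = +-positive
    infixl 7 _⟨*⟩_
    _⟨*⟩_ : ∀ {x y} → Positive x → Positive y → Positive (x * y)
    _⟨*⟩_ = *-positive

    defect≈0 : recurrenceDefect z r ≈ 0ℝ
    defect≈0 = x≈y⇒x-y≈0 z₁₁₁≈

    a>0 = z>0 O O O

  -- K₀₀₀ is identically ½ (z₁₁₁ z₀₀₀² - A), and the recurrence makes the bracket 2r.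
  K≈r : kashaevK z ≈ r
  K≈r = x≈y+t*0⇒x≈y defect≈0
    (prove (env z r) (Poly.kashaevK Z) (S :+ con ½ :* Poly.recurrenceDefect Z S) ≈-refl)

  kashaevForm≈0 : kashaevForm z ≈ 0ℝ
  kashaevForm≈0 = x*y≈0⇒y≈0 (½>0 ⟨*⟩ ½>0 ⟨*⟩ (a>0 ⟨*⟩ a>0)) (begin
    ½ℝ * ½ℝ * z O O O ² * kashaevForm z                       ≈⟨ prove (env z 0ℝ)
        (con ½ :* con ½ :* (Z O O O :* Z O O O) :* Poly.kashaevForm Z)
        (Poly.kashaevK Z :* Poly.kashaevK Z :+ :- Poly.discriminant Z) ≈-refl ⟩
    kashaevK z ² - discriminant z                             ≈⟨ x≈y⇒x-y≈0 (≈-trans (*-cong K≈r K≈r) r²≈D) ⟩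
    0ℝ                                                        ∎)
    where
    open ≈-Reasoning
    ½>0 : Positive ½ℝ
    ½>0 = fromℚ-positive (ℚₚ.positive⁻¹ ½)

  -- `K²-identity` is applied to the cube seen from `u`; its error term is a multiple of
  -- `kashaevForm`, which vanishes from every vertex because it vanishes from 000.
  K²≈D : ∀ u → kashaevK (reflect u z) ² ≈ discriminant (reflect u z)
  K²≈D u = x≈y+t*0⇒x≈y {t = ½ℝ * ½ℝ * reflect u z O O O ²}
    (≈-trans (kashaevForm-reflect u z) kashaevForm≈0) (K²-identity (reflect u z))

  private
    2>0 : Positive 2ℝ
    2>0 = fromℚ-positive (ℚₚ.positive⁻¹ (1ℚ ℚ.+ 1ℚ))

    neighbourValue>0 : ∀ {a b b′ b″ c′ c″} → Positive a → Positive b → Positive b′ → Positive b″ →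
      Positive c′ → Positive c″ → Positive (neighbourValue a b b′ b″ c′ c″ r)
    neighbourValue>0 a b b′ b″ c′ c″ =
      b ⟨*⟩ (b ⟨*⟩ b′ ⟨*⟩ b″ ⟨+⟩ a ⟨*⟩ (b′ ⟨*⟩ c′) ⟨+⟩ a ⟨*⟩ (b″ ⟨*⟩ c″) ⟨+⟩ r>0) ⟨+⟩ a ⟨*⟩ a ⟨*⟩ (c′ ⟨*⟩ c″)

    remoteValue>0 : ∀ {a b b′ b″ c c′ c″ d} → Positive a → Positive b → Positive b′ → Positive b″ →
      Positive c → Positive c′ → Positive c″ → Positive d → Positive (remoteValue a b b′ b″ c c′ c″ d r)
    remoteValue>0 a b b′ b″ c c′ c″ d =
      c ⟨*⟩ (b ⟨*⟩ b′ ⟨*⟩ b″ ⟨+⟩ a ⟨*⟩ (b′ ⟨*⟩ c′) ⟨+⟩ a ⟨*⟩ (b″ ⟨*⟩ c″) ⟨+⟩ r>0) ⟨+⟩ a ⟨*⟩ (b′ ⟨*⟩ b″ ⟨*⟩ d)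

    antipodeValue>0 : Positive (antipodeValue z r)
    antipodeValue>0 = (A>0 ⟨+⟩ 2>0 ⟨*⟩ r>0) ⟨*⟩ (b₁ ⟨*⟩ b₂ ⟨*⟩ b₃) ⟨+⟩ A>0 ⟨*⟩ r>0
        ⟨+⟩ (a ⟨*⟩ c₁ ⟨+⟩ b₂ ⟨*⟩ b₃) ⟨*⟩ (a ⟨*⟩ c₂ ⟨+⟩ b₁ ⟨*⟩ b₃) ⟨*⟩ (a ⟨*⟩ c₃ ⟨+⟩ b₁ ⟨*⟩ b₂)
        ⟨+⟩ (a ⟨*⟩ c₁ ⟨*⟩ (a ⟨*⟩ c₂) ⟨*⟩ (b₁ ⟨*⟩ b₂) ⟨+⟩ a ⟨*⟩ c₁ ⟨*⟩ (b₁ ⟨*⟩ b₃) ⟨*⟩ (a ⟨*⟩ c₃ ⟨+⟩ b₁ ⟨*⟩ b₂)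
            ⟨+⟩ b₂ ⟨*⟩ b₃ ⟨*⟩ (a ⟨*⟩ c₂ ⟨+⟩ b₁ ⟨*⟩ b₃) ⟨*⟩ (a ⟨*⟩ c₃ ⟨+⟩ b₁ ⟨*⟩ b₂))
      where
      a = z>0 O O O
      b₁ = z>0 I O O
      b₂ = z>0 O I O
      b₃ = z>0 O O I
      c₁ = z>0 O I I
      c₂ = z>0 I O I
      c₃ = z>0 I I O
      A>0 : Positive (numeratorA z)
      A>0 = 2>0 ⟨*⟩ b₁ ⟨*⟩ b₂ ⟨*⟩ b₃ ⟨+⟩ a ⟨*⟩ (b₁ ⟨*⟩ c₁ ⟨+⟩ b₂ ⟨*⟩ c₂ ⟨+⟩ b₃ ⟨*⟩ c₃)

    -- A sign certificate: a positive multiple of `y` agrees with a positive `E` modulo the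
    -- recurrence.
    divide : ∀ {m y E t} → Positive m → Positive E → m * y ≈ E + t * recurrenceDefect z r → Positive y
    divide m>0 E>0 my≈ = *-positive⁻ʳ m>0 (Positive-resp-≈ (≈-sym (x≈y+t*0⇒x≈y defect≈0 my≈)) E>0)

  orient-K>0 : ∀ u → Positive (orient u (kashaevK (reflect u z)))
  orient-K>0 (O , O , O) = Positive-resp-≈ (≈-sym K≈r) r>0
  -- In -z₀₀₀ K at each of the next six vertices u, the coefficient of z₀₀₀² z₁₁₁ is ½ z at u, hence
  -- the cofactor. Substituting A + 2r cancels the only negative term, -½ z₀₀₀ times the square of z
  -- at u times z opposite u. Within each group of three, the cases differ by a cyclic permutation
  -- of the axes.
  orient-K>0 (I , O , O) = divide a>0
    (neighbourValue>0 a>0 (z>0 I O O) (z>0 O I O) (z>0 O O I) (z>0 I O I) (z>0 I I O))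
    (prove (env z r) (Z O O O :* (:- Poly.kashaevK (reflect (I , O , O) Z)))
      (Poly.neighbourValue (Z O O O) (Z I O O) (Z O I O) (Z O O I) (Z I O I) (Z I I O) S
        :+ con ½ :* Z I O O :* Poly.recurrenceDefect Z S) ≈-refl)
  orient-K>0 (O , I , O) = divide a>0
    (neighbourValue>0 a>0 (z>0 O I O) (z>0 O O I) (z>0 I O O) (z>0 I I O) (z>0 O I I))
    (prove (env z r) (Z O O O :* (:- Poly.kashaevK (reflect (O , I , O) Z)))
      (Poly.neighbourValue (Z O O O) (Z O I O) (Z O O I) (Z I O O) (Z I I O) (Z O I I) S
        :+ con ½ :* Z O I O :* Poly.recurrenceDefect Z S) ≈-refl)
  orient-K>0 (O , O , I) = divide a>0
    (neighbourValue>0 a>0 (z>0 O O I) (z>0 I O O) (z>0 O I O) (z>0 O I I) (z>0 I O I))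
    (prove (env z r) (Z O O O :* (:- Poly.kashaevK (reflect (O , O , I) Z)))
      (Poly.neighbourValue (Z O O O) (Z O O I) (Z I O O) (Z O I O) (Z O I I) (Z I O I) S
        :+ con ½ :* Z O O I :* Poly.recurrenceDefect Z S) ≈-refl)
  orient-K>0 (O , I , I) = divide a>0
    (remoteValue>0 a>0 (z>0 I O O) (z>0 O I O) (z>0 O O I) (z>0 O I I) (z>0 I O I) (z>0 I I O) (z>0 I I I))
    (prove (env z r) (Z O O O :* (:- Poly.kashaevK (reflect (O , I , I) Z)))
      (Poly.remoteValue (Z O O O) (Z I O O) (Z O I O) (Z O O I) (Z O I I) (Z I O I) (Z I I O) (Z I I I) S
        :+ con ½ :* Z O I I :* Poly.recurrenceDefect Z S) ≈-refl)
  orient-K>0 (I , O , I) = divide a>0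
    (remoteValue>0 a>0 (z>0 O I O) (z>0 O O I) (z>0 I O O) (z>0 I O I) (z>0 I I O) (z>0 O I I) (z>0 I I I))
    (prove (env z r) (Z O O O :* (:- Poly.kashaevK (reflect (I , O , I) Z)))
      (Poly.remoteValue (Z O O O) (Z O I O) (Z O O I) (Z I O O) (Z I O I) (Z I I O) (Z O I I) (Z I I I) S
        :+ con ½ :* Z I O I :* Poly.recurrenceDefect Z S) ≈-refl)
  orient-K>0 (I , I , O) = divide a>0
    (remoteValue>0 a>0 (z>0 O O I) (z>0 I O O) (z>0 O I O) (z>0 I I O) (z>0 O I I) (z>0 I O I) (z>0 I I I))
    (prove (env z r) (Z O O O :* (:- Poly.kashaevK (reflect (I , I , O) Z)))
      (Poly.remoteValue (Z O O O) (Z O O I) (Z I O O) (Z O I O) (Z I I O) (Z O I I) (Z I O I) (Z I I I) S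
        :+ con ½ :* Z I I O :* Poly.recurrenceDefect Z S) ≈-refl)
  -- z₀₀₀³ K₁₁₁ is quadratic in y = z₀₀₀² z₁₁₁, so the cofactor is the divided difference between y
  -- and A + 2r. The summand 2 (r² - D), which is zero, trades r² for D.
  orient-K>0 (I , I , I) = divide (a>0 ⟨*⟩ a>0 ⟨*⟩ a>0)
    (Positive-resp-≈ (≈-sym (x≈y+t*0⇒x≈y (x≈y⇒x-y≈0 r²≈D) ≈-refl)) antipodeValue>0)
    (prove (env z r) (Z O O O :* Z O O O :* Z O O O :* Poly.kashaevK (reflect (I , I , I) Z))
      (Poly.antipodeValue Z S :+ Poly.two :* (S :* S :+ :- Poly.discriminant Z)
        :+ Poly.oneHalf :* (Poly.numeratorA Z :+ Poly.two :* S :+ Z I I I :* (Z O O O :* Z O O O) :+ :- (Z O O O :* Poly.diagonals Z))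
          :* Poly.recurrenceDefect Z S) ≈-refl)

-- Products around a vertex

∏-cong : ∀ {A} xs {f g : A → ℝ} → (∀ a → f a ≈ g a) → ∏ xs f ≈ ∏ xs g
∏-cong []       f≈g = ≈-refl
∏-cong (a ∷ xs) f≈g = *-cong (f≈g a) (∏-cong xs f≈g)

∏-² : ∀ {A} xs (f : A → ℝ) → ∏ xs f ² ≈ ∏ xs (λ a → f a ²)
∏-² []       f = *-identityˡ 1ℝ
∏-² (a ∷ xs) f = ≈-trans
  (solve 2 (λ y p → (y :* p) :* (y :* p) := (y :* y) :* (p :* p)) ≈-refl (f a) (∏ xs f))
  (*-congˡ (∏-² xs f))
  where open ℝ-Solver

∏-positive : ∀ {A} xs {f : A → ℝ} → (∀ a → Positive (f a)) → Positive (∏ xs f)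
∏-positive []       f>0 = fromℚ-positive (ℚₚ.positive⁻¹ 1ℚ)
∏-positive (a ∷ xs) f>0 = *-positive (f>0 a) (∏-positive xs f>0)

-- Six of the eight factors are negated, so the signs cancel.
∏-orient : ∀ f → ∏ bits³ f ≈ ∏ bits³ (λ u → orient u (f u))
∏-orient f = solve 8 (λ f₀ f₁ f₂ f₃ f₄ f₅ f₆ f₇ →
  f₀ :* (f₁ :* (f₂ :* (f₃ :* (f₄ :* (f₅ :* (f₆ :* (f₇ :* con 1ℚ)))))))
    := f₀ :* (:- f₁ :* (:- f₂ :* (:- f₃ :* (:- f₄ :* (:- f₅ :* (:- f₆ :* (f₇ :* con 1ℚ)))))))) ≈-refl
  (f (O , O , O)) (f (O , O , I)) (f (O , I , O)) (f (O , I , I)) (f (I , O , O)) (f (I , O , I)) (f (I , I , O)) (f (I , I , I))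
  where open ℝ-Solver

-- Each square at a vertex is a face of exactly two of the cubes at that vertex.
∏-faces : ∀ (f : Fin 3 × Bit² → ℝ) →
  ∏ bits³ (λ (i , j , k) → f (0F , j , k) * f (1F , i , k) * f (2F , i , j)) ≈ ∏ (cartesianProduct axes bits²) f ²
∏-faces f = solve 12 (λ a b c d e g h i j k l m →
  a :* e :* j :* (b :* g :* j :* (c :* e :* k :* (d :* g :* k :* (a :* h :* l :* (b :* i :* l :* (c :* h :* m :* (d :* i :* m :* con 1ℚ)))))))
    := a :* (b :* (c :* (d :* (e :* (g :* (h :* (i :* (j :* (k :* (l :* (m :* con 1ℚ)))))))))))
     :* (a :* (b :* (c :* (d :* (e :* (g :* (h :* (i :* (j :* (k :* (l :* (m :* con 1ℚ)))))))))))))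
  ≈-refl
  (f (0F , O , O)) (f (0F , O , I)) (f (0F , I , O)) (f (0F , I , I))
  (f (1F , O , O)) (f (1F , O , I)) (f (1F , I , O)) (f (1F , I , I))
  (f (2F , O , O)) (f (2F , O , I)) (f (2F , I , O)) (f (2F , I , I))
  where open ℝ-Solver

-- a is the end ⟦ i ⟧ of a unit interval; s = O selects a itself and s = I the other end.
step : ℤ → Bit → Bit → ℤ
step a i s = a ℤ.- ⟦ i ⟧ ℤ.+ ⟦ i xor s ⟧

-- The right side is kept as a - 0 + 0 because that is the form of the normal coordinate in
-- `squareVertex`.
step-origin : ∀ a i → step a i O ≡ step a O O
step-origin a O = refl
step-origin a I = trans (ℤₚ.+-assoc a (ℤ.- ℤ.1ℤ) ℤ.1ℤ) (sym (ℤₚ.+-assoc a ℤ.0ℤ ℤ.0ℤ))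

module _ (x : Point → ℝ) (v : Point) where

  cubeAround : Bit³ → Cube ℝ
  cubeAround u i j k = x (v ⊖ u ⊕ (i , j , k))

  squareTerm : Fin 3 × Bit² → ℝ
  squareTerm du = squareFactor x (squareAt v du)

-- The three factors of D at `v` belong to the three faces through `v`. The cube and the square
-- write the normal coordinate differently, which `step-origin` repairs; splitting on the two
-- in-plane bits lets `xor` and `not` compute.
discriminant-faces : ∀ x v i j k → discriminant (reflect (i , j , k) (cubeAround x v (i , j , k)))
  ≡ squareTerm x v (0F , j , k) * squareTerm x v (1F , i , k) * squareTerm x v (2F , i , j)
discriminant-faces x (a , b , c) i j k = cong₂ _*_ (cong₂ _*_
    (trans (cong (face (λ s t w → x (w , step b j s , step c k t))) (step-origin a i)) (normal₀ j k))
    (trans (cong (face (λ s t w → x (step a i s , w , step c k t))) (step-origin b j)) (normal₁ i k)))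
    (trans (cong (face (λ s t w → x (step a i s , step b j t , w))) (step-origin c k)) (normal₂ i j))
  where
  face : (Bit → Bit → ℤ → ℝ) → ℤ → ℝ
  face y w = y O O w * y I I w + y I O w * y O I w
  normal₀ : ∀ j k → face (λ s t w → x (w , step b j s , step c k t)) (step a O O) ≡ squareTerm x (a , b , c) (0F , j , k)
  normal₀ O O = refl
  normal₀ O I = refl
  normal₀ I O = refl
  normal₀ I I = refl
  normal₁ : ∀ i k → face (λ s t w → x (step a i s , w , step c k t)) (step b O O) ≡ squareTerm x (a , b , c) (1F , i , k)
  normal₁ O O = refl
  normal₁ O I = refl
  normal₁ I O = refl
  normal₁ I I = refl
  normal₂ : ∀ i j → face (λ s t w → x (step a i s , step b j t , w)) (step c O O) ≡ squareTerm x (a , b , c) (2F , i , j)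
  normal₂ O O = refl
  normal₂ O I = refl
  normal₂ I O = refl
  normal₂ I I = refl

theorem2p9 : (x : Point → ℝ) (x>0 : ∀ s → Positive (x s)) → PositiveKashaev x x>0 →
    ∀ (v : Point) → ∏ (cubesAt v) (K x) ≈ ∏ (squaresAt v) (squareFactor x)
-- Both lists of the statement are images of explicit lists, so the products unfold to ones indexed
-- by `bits³` and by `cartesianProduct axes bits²`.
theorem2p9 x x>0 kashaev v = ²-injective ∏k>0 ∏squares>0 (begin
  ∏ bits³ k ²                                                   ≈⟨ ∏-² bits³ k ⟩
  ∏ bits³ (λ u → k u ²)                                         ≈⟨ ∏-cong bits³ (λ u → ≈-trans (k²≈ u) (reflexive (discriminant-faces x v _ _ _))) ⟩
  ∏ bits³ (λ (i , j , k) → squareTerm x v (0F , j , k) * squareTerm x v (1F , i , k) * squareTerm x v (2F , i , j))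
                                                                ≈⟨ ∏-faces (squareTerm x v) ⟩
  ∏ (cartesianProduct axes bits²) (squareTerm x v) ²            ∎)
  where
  open ≈-Reasoning
  k : Bit³ → ℝ
  k u = K x (cubeAt v u)
  -- The cube with `v` at position `u` has minimal vertex `v ⊖ u`, so the recurrence is used there.
  module CubeAt (u : Bit³) where
    z₀₀₀>0 = x>0 (v ⊖ u ⊕ (O , O , O))
    sqrt = proj₁ (proj₂ (kashaev (v ⊖ u)))
    recurrence = proj₂ (proj₂ (kashaev (v ⊖ u)))
    open KashaevCube (cubeAround x v u) (λ _ _ _ → x>0 _) (proj₁ (kashaev (v ⊖ u))) (proj₁ sqrt) (proj₂ sqrt)
      -- Multiplying by z₀₀₀² removes the division.
      (≈-trans (*-cong recurrence ≈-refl) (/-cancel _ (*-positive z₀₀₀>0 z₀₀₀>0))) public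
  k²≈ : ∀ u → k u ² ≈ discriminant (reflect u (cubeAround x v u))
  -- The first `u` chooses the cube and the second its vertex `v`; `k u` unfolds to `kashaevK` of
  -- the reflected cube.
  k²≈ u = CubeAt.K²≈D u u
  ∏k>0 : Positive (∏ bits³ k)
  ∏k>0 = Positive-resp-≈ (≈-sym (∏-orient k)) (∏-positive bits³ (λ u → CubeAt.orient-K>0 u u))
  squareTerm>0 : ∀ du → Positive (squareTerm x v du)
  squareTerm>0 _ = +-positive (*-positive (x>0 _) (x>0 _)) (*-positive (x>0 _) (x>0 _))
  ∏squares>0 : Positive (∏ (cartesianProduct axes bits²) (squareTerm x v))
  ∏squares>0 = ∏-positive (cartesianProduct axes bits²) squareTerm>0
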